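{- Let $P$ be a Featherweight Java program that is well-typed with respect to a class table $(F,M)$ (in the region-and-effect sense defined in the context), and let $\eta$ be an infinitary effect typing for $M$. For any $\Gamma,e,T,S,s,h,v,h',w$ with $\Gamma\vdash e:T\ \mathsf{calls}\ S$ (derivable with respect to $(F,M)$) and $(s,h)\vdash\Gamma,F$: (1) if $(s,h)\vdash e\Downarrow v,h'\mathrel{\&}w$, then $(s,h')\vdash\Gamma,F$ and $(v,h')\vdash r$ and $w\in U$ for some $(r\mathrel{\&}U)\in T$; (2) if $(s,h)\vdash e\Uparrow\mathrel{\&}w$, then $w\in S(\eta)$, where $S(\eta)\subseteq\Sigma^{\le\omega}$ is obtained by substituting every occurrence of each method signature $\delta$ in $S$ by $\eta(\delta)$.
   Context: WORDS. $\Sigma$ is a finite alphabet, $\Sigma^*$ the finite words ($\varepsilon$ the empty word), $\Sigma^{\le\omega}$ the finite and infinite words; $U\cdot V=\{uv\mid u\in U,v\in V\}$ for $U\subseteq\Sigma^*$ and $V\subseteq\Sigma^*$ or $V\subseteq\Sigma^{\le\omega}$. $\mathcal P$ is powerset. SYNTAX. Sets of names: variables $\mathit{Var}\ni\mathtt{this}$, classes $\mathit{Cls}\ni\mathtt{Object},\mathtt{NullType}$, fields $\mathit{Fld}$, methods $\mathit{Mtd}$, labels $\mathit{Pos}$. Expressions: $e::=x\mid\mathtt{let}\ x=e_1\ \mathtt{in}\ e_2\mid\mathtt{if}\ x=y\ \mathtt{then}\ e_1\ \mathtt{else}\ e_2\mid\mathtt{null}\mid\mathtt{new}^{\ell}\,C\mid(C)\,e\mid\mathtt{emit}(a)\mid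 x^C.m(\bar y)\mid x^C.f\mid x^C.f:=y$ with $a\in\Sigma$, $\ell\in\mathit{Pos}$; $\mathtt{NullType}$ may not occur in $\mathtt{new}$ or casts. The annotation in $x^C$ says that $x$ is a variable of type (class) $C$; annotations are omitted where not needed. PROGRAMS. A program $(\prec,\mathit{fields},\mathit{methods},\mathit{mtable})$ has a finite immediate-subclass relation $\prec$ on $\mathit{Cls}$, maps $\mathit{fields},\mathit{methods}$ from classes to finite sets of fields, resp. methods (including inherited ones), and a partial map $\mathit{mtable}$ from $\mathit{Cls}\times\mathit{Mtd}$ to pairs $(\bar x,e)$ (formal parameters and body). $\preceq$ is the reflexive transitive closure of $\prec$; $C\preceq\mathtt{Object}$ and $\mathtt{NullType}\preceq C$ for all $C$. Programs are required to be well-formed in the usual sense: apart from $\mathtt{NullType}$ the classes form a tree with root $\mathtt{Object}$; for $C\preceq D$ with $C\neq\mathtt{NullType}$, $\mathit{fields}(D)\subseteq\mathit{fields}(C)$ and $\mathit{methods}(D)\subseteq\mathit{methods}(C)$; $\mathtt{NullType}$ has no fields or methods; $\mathit{mtable}(C,m)$ is defined iff $m\in\mathit{methods}(C)$, and methods keep their number of parameters in subclasses. STANDARD FJ TYPING (standing assumption on programs). Only programs well-typed in the standard Featherweight Java type system, in which types are classes, are considered: there are a field typing $F_0:\mathit{Cls}\times\mathit{Fld}\rightharpoonup\mathit{Cls}$, giving the class of each field $f\in\mathit{fields}(C)$, and a method typing $M_0:\mathit{Cls}\times\mathit{Mtd}\rightharpoonup\mathit{Cls}^*\times\mathit{Cls}$,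 giving the argument and result classes of each method $m\in\mathit{methods}(C)$, with respect to which all method bodies of the program are typable in the standard way. OPERATIONAL SEMANTICS. Values are $\mathit{null}$ or locations $l\in\mathit{Loc}$; a store is a partial map $s$ from variables to values; a heap is a partial map $h$ from locations to objects $(C,G,\ell)$ with $C\in\mathit{Cls}$, $G:\mathit{Fld}\rightharpoonup$ values, $\ell\in\mathit{Pos}$. $\mathrm{classOf}_h(\mathit{null})=\mathtt{NullType}$, $\mathrm{classOf}_h(l)=C$ if $h(l)=(C,\_,\_)$. Terminating evaluation $(s,h)\vdash e\Downarrow v,h'\mathrel{\&}w$ (with $w\in\Sigma^*$) is the inductively generated relation with rules: - $(s,h)\vdash\mathtt{emit}(a)\Downarrow\mathit{null},h\mathrel{\&}a$; $(s,h)\vdash x\Downarrow s(x),h\mathrel{\&}\varepsilon$; $(s,h)\vdash\mathtt{null}\Downarrow\mathit{null},h\mathrel{\&}\varepsilon$. - $\mathtt{if}\ x=y\ \mathtt{then}\ e_1\ \mathtt{else}\ e_2$ evaluates as $e_1$ (same $v,h',w$) if $s(x)=s(y)$, and as $e_2$ if $s(x)\ne s(y)$. - If $(s,h)\vdash e_1\Downarrow v_1,h_1\mathrel{\&}w_1$ and $(s[x\mapsto v_1],h_1)\vdash e_2\Downarrow v_2,h_2\mathrel{\&}w_2$, then $(s,h)\vdash\mathtt{let}\ x=e_1\ \mathtt{in}\ e_2\Downarrow v_2,h_2\mathrel{\&}w_1w_2$. - If $l\notin\mathrm{dom}(h)$ and $G=[f\mapsto\mathit{null}]_{f\in\mathit{fields}(C)}$,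 then $(s,h)\vdash\mathtt{new}^\ell C\Downarrow l,h[l\mapsto(C,G,\ell)]\mathrel{\&}\varepsilon$. - If $(s,h)\vdash e\Downarrow v,h'\mathrel{\&}w$ and $\mathrm{classOf}_{h'}(v)\preceq C$, then $(s,h)\vdash(C)e\Downarrow v,h'\mathrel{\&}w$. - If $s(x)=l$, $h(l)=(D,G,\ell)$: $(s,h)\vdash x.f\Downarrow G(f),h\mathrel{\&}\varepsilon$ and $(s,h)\vdash x.f:=y\Downarrow s(y),h[l\mapsto(D,G[f\mapsto s(y)],\ell)]\mathrel{\&}\varepsilon$. - If $s(x)=l$, $h(l)=(D,\_,\_)$, $\mathit{mtable}(D,m)=(\bar z,e)$ and $([\mathtt{this}\mapsto l]\cup[z_i\mapsto s(y_i)]_i,h)\vdash e\Downarrow v,h'\mathrel{\&}w$, then $(s,h)\vdash x.m(\bar y)\Downarrow v,h'\mathrel{\&}w$. Divergence $(s,h)\vdash e\Uparrow\mathrel{\&}w$ (with $w\in\Sigma^{\le\omega}$) is defined coinductively (largest relation each of whose instances is the conclusion of a rule with premises in the relation) by: $\mathtt{if}$ diverges with $w$ if the selected branch does; $\mathtt{let}\ x=e_1\ \mathtt{in}\ e_2$ diverges with $w_1w_2$ if $(s,h)\vdash e_1\Downarrow v_1,h_1\mathrel{\&}w_1$ and $(s[x\mapsto v_1],h_1)\vdash e_2\Uparrow\mathrel{\&}w_2$; $\mathtt{let}\ x=e_1\ \mathtt{in}\ e_2$ diverges with $w$ if $e_1$ does; $(C)e$ diverges with $w$ if $e$ does; and $x.m(\bar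 y)$ diverges with $w$ if, with $l,D,\bar z,e$ as in the evaluation rule for calls, $([\mathtt{this}\mapsto l]\cup[z_i\mapsto s(y_i)]_i,h)\vdash e\Uparrow\mathrel{\&}w$. REGIONS. $\mathit{Reg}\ni r::=\mathtt{Null}\mid\mathtt{CreatedAt}(\ell)\mid\mathtt{Unknown}$. $\mathit{Cls}(\mathtt{Null})=\emptyset$, $\mathit{Cls}(\mathtt{CreatedAt}(\ell))=\{C\mid\text{the program contains }\mathtt{new}^\ell C\}$, $\mathit{Cls}(\mathtt{Unknown})=\mathit{Cls}$. $\mathtt{Null}$ and all $\mathtt{CreatedAt}(\ell)$ are pairwise disjoint; $\mathtt{Unknown}$ is disjoint from no region. EFFECT EXPRESSIONS. For a set $K$, $\mathcal P(\Sigma^*)\langle K\rangle$ is the set of finite partial functions from $K$ to $\mathcal P(\Sigma^*)$, with $\emptyset$ the empty one; $T(x)$ is treated as $\emptyset$ for $x\notin\mathrm{dom}(T)$. $T\subseteq T'$ iff $T(x)\subseteq T'(x)$ for all $x\in K$; $(T\cup T')(x)=T(x)\cup T'(x)$; $(U\cdot T)(x)=U\cdot T(x)$. $r_1\mathrel{\&}U_1\mid\dots\mid r_n\mathrel{\&}U_n$ denotes the element of $\mathcal P(\Sigma^*)\langle\mathit{Reg}\rangle$ mapping $r_i\mapsto U_i$, and $(r\mathrel{\&}U)\in T$ means $r\in\mathrm{dom}(T)$, $T(r)=U$. A method signature is a tuple $(C,r,m,\bar s)$ with $m\in\mathit{methods}(C)$, $r\in\mathit{Reg}$, $\bar s$ a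 list of regions, one per argument of $m$; $\mathit{Sig}$ is the set of these. A call expression is an element $S=U_1\cdot\delta_1\cup\dots\cup U_k\cdot\delta_k$ of $\mathcal P(\Sigma^*)\langle\mathit{Sig}\rangle$ (mapping $\delta_i\mapsto U_i$); $\delta$ alone abbreviates $\{\varepsilon\}\cdot\delta$. For $\eta:\mathit{Sig}\to\mathcal P(\Sigma^{\le\omega})$, $S(\eta)=\bigcup_i U_i\cdot\eta(\delta_i)$. CLASS TABLES. A class table $(F,M)$ consists of $F:\mathit{Cls}\times\mathit{Reg}\times\mathit{Fld}\rightharpoonup\mathcal P(\mathit{Reg})$ (defined for $f\in\mathit{fields}(C)$) and $M:\mathit{Sig}\to\mathcal P(\Sigma^*)\langle\mathit{Reg}\rangle\times\mathcal P(\Sigma^*)\langle\mathit{Sig}\rangle$, well-formed (wherever the entries are defined): $\mathtt{Null}\in F(C,r,f)\subseteq F(C,\mathtt{Unknown},f)$; $F(C,r,f)=F(D,r,f)$ if $C\preceq D$, $f\in\mathit{fields}(D)$; $M(C,r,m,\bar s)\subseteq M(D,r,m,\bar s)$ componentwise if $C\preceq D$, $m\in\mathit{methods}(D)$. TYPING RULES. $\Gamma:\mathit{Var}\rightharpoonup\mathit{Reg}$; judgments $\Gamma\vdash e:T\ \mathsf{calls}\ S$ are derived by: - (sub) from $\Gamma\vdash e:T\ \mathsf{calls}\ S$, $T\subseteq T'$, $S\subseteq S'$ infer $\Gamma\vdash e:T'\ \mathsf{calls}\ S'$. - (weak) from $\Gamma\vdash e:(r\mathrel{\&}U)\cup T\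 \mathsf{calls}\ S$ infer $\Gamma\vdash e:(\mathtt{Unknown}\mathrel{\&}U)\cup T\ \mathsf{calls}\ S$. - (prim) $\Gamma\vdash\mathtt{emit}(a):\mathtt{Null}\mathrel{\&}\{a\}\ \mathsf{calls}\ \emptyset$. (null) $\Gamma\vdash\mathtt{null}:\mathtt{Null}\mathrel{\&}\{\varepsilon\}\ \mathsf{calls}\ \emptyset$. (new) $\Gamma\vdash\mathtt{new}^\ell C:\mathtt{CreatedAt}(\ell)\mathrel{\&}\{\varepsilon\}\ \mathsf{calls}\ \emptyset$. (var) $\Gamma\vdash x:\Gamma(x)\mathrel{\&}\{\varepsilon\}\ \mathsf{calls}\ \emptyset$. - (if) from $\Gamma\vdash e_i:T_i\ \mathsf{calls}\ S_i$ ($i=1,2$), $x,y\in\mathrm{dom}(\Gamma)$, infer $\Gamma\vdash\mathtt{if}\ x=y\ \mathtt{then}\ e_1\ \mathtt{else}\ e_2:T_1\cup T_2\ \mathsf{calls}\ S_1\cup S_2$. - (else) if $\Gamma(x),\Gamma(y)$ are disjoint, from $\Gamma\vdash e_2:T_2\ \mathsf{calls}\ S_2$ infer $\Gamma\vdash\mathtt{if}\ x=y\ \mathtt{then}\ e_1\ \mathtt{else}\ e_2:T_2\ \mathsf{calls}\ S_2$. - (let) from $\Gamma\vdash e_1:r_1\mathrel{\&}U_1\mid\dots\mid r_n\mathrel{\&}U_n\ \mathsf{calls}\ S$ and $\Gamma,x{:}r_i\vdash e_2:T_i\ \mathsf{calls}\ S_i$ for all $i$ infer $\Gamma\vdash\mathtt{let}\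 x=e_1\ \mathtt{in}\ e_2:\bigcup_iU_i\cdot T_i\ \mathsf{calls}\ S\cup\bigcup_iU_i\cdot S_i$. - (cast) from $\Gamma\vdash e:T\ \mathsf{calls}\ S$ infer $\Gamma\vdash(D)e:T\ \mathsf{calls}\ S$. - (get) $\Gamma\vdash x^C.f:\bigcup\{s\mathrel{\&}\{\varepsilon\}\mid s\in F(C,\Gamma(x),f)\}\ \mathsf{calls}\ \emptyset$. - (set) if $\Gamma(y)\in F(C,\Gamma(x),f)$, then $\Gamma\vdash x^C.f:=y:\Gamma(y)\mathrel{\&}\{\varepsilon\}\ \mathsf{calls}\ \emptyset$. - (call) if $r=\Gamma(x)$, $\bar s=\Gamma(\bar y)$, $(T,\_)=M(C,r,m,\bar s)$, then $\Gamma\vdash x^C.m(\bar y):T\ \mathsf{calls}\ (C,r,m,\bar s)$. A program is well-typed w.r.t. $(F,M)$ if for each $(C,r,m,\bar s)\in\mathit{Sig}$ with $C\in\mathit{Cls}(r)$, $M(C,r,m,\bar s)=(T,S)$, $\mathit{mtable}(C,m)=(\bar x,e)$, the judgment $\mathtt{this}{:}r,\bar x{:}\bar s\vdash e:T\ \mathsf{calls}\ S$ is derivable. INFINITARY EFFECT TYPING. Let $S_\delta$ be the second component of $M(\delta)$. $\eta:\mathit{Sig}\to\mathcal P(\Sigma^{\le\omega})$ is an infinitary effect typing for $M$ if it is the greatest solution (pointwise inclusion) of the equation system $\{\delta=S_\delta\mid\delta\in\mathit{Sig}\}$, i.e. of $\eta(\delta)=S_\delta(\eta)$ for all $\delta$.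 REGION SATISFACTION. $(v,h)\vdash r$ is generated by: $(\mathit{null},h)\vdash\mathtt{Null}$; $(v,h)\vdash\mathtt{Unknown}$; $(l,h)\vdash\mathtt{CreatedAt}(\ell)$ if $h(l)=(C,G,\ell)$ and $C\in\mathit{Cls}(\mathtt{CreatedAt}(\ell))$. For a set $R$ of regions, $(v,h)\vdash R$ means $(v,h)\vdash r$ for some $r\in R$. $(s,h)\vdash\Gamma$ iff $(s(x),h)\vdash r$ for all $(x{:}r)\in\Gamma$. $h\vdash F$ iff $(G(f),h)\vdash F(C,r,f)$ for all $l\in\mathrm{dom}(h)$ with $h(l)=(C,G,\_)$ and for all $r,f$ with $(C,r,f)\in\mathrm{dom}(F)$. $(s,h)\vdash\Gamma,F$ denotes the conjunction of $(s,h)\vdash\Gamma$ and $h\vdash F$.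
   Formalization: False as stated. Mended: (set) with Γ(x)=Unknown also requires Γ(y) in F(D,CreatedAt(ℓ),f) for all D⪯C created at ℓ; h⊢F concerns only regions r with (l,h)⊢r; e is FJ-typed, s and h conform to standard typing; each new^ℓ C in e occurs in the program. -}

module Defs where

open import Data.Bool.Base using (if_then_else_)
open import Data.Empty using (⊥)
open import Data.Fin.Base using (Fin)
open import Data.List.Base using (List; []; _∷_; [_]; _++_; length; zip; concatMap)
open import Data.List.Membership.Propositional using (_∈_; lose)
open import Data.List.Membership.Propositional.Properties using (∈-++⁺ˡ; ∈-++⁺ʳ; ∈-concatMap⁺)
import Data.List.Membership.DecPropositional as DecMembership
open import Data.List.Relation.Binary.Pointwise using (Pointwise)
open import Data.List.Relation.Binary.Subset.Propositional using () renaming (_⊆_ to _⊆ˡ_)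
open import Data.List.Relation.Unary.Any using (here)
open import Data.Maybe using (Maybe; just; nothing; maybe′; Is-just)
open import Data.Nat.Base using (ℕ; zero; suc)
open import Data.Product using (Σ-syntax; ∃-syntax; _×_; _,_; proj₁; proj₂)
open import Data.Sum.Base using (inj₁; inj₂)
open import Data.Unit.Base using (⊤)
open import Function.Base using (_∘_)
open import Function.Bundles using (_⇔_; _↔_)
open import Level using (0ℓ)
open import Relation.Binary.Construct.Closure.ReflexiveTransitive using (Star)
open import Relation.Binary.Definitions using (DecidableEquality)
open import Relation.Binary.PropositionalEquality using (_≡_; _≢_; refl; _≗_)
open import Relation.Nullary using (¬_; does)
open import Relation.Unary using (Pred; _⊆_; _≐_; _∪_; ｛_｝)

------------------------------------------------------------------------
-- Partial maps

infix 4 _⇀_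

_⇀_ : Set → Set → Set
A ⇀ B = A → Maybe B

module Update {A : Set} (_≟_ : DecidableEquality A) where

  _[_↦_] : {B : Set} → (A ⇀ B) → A → B → (A ⇀ B)
  (g [ a ↦ b ]) a′ = if does (a′ ≟ a) then just b else g a′

  fromList : {B : Set} → List (A × B) → (A ⇀ B)
  fromList []             = λ _ → nothing
  fromList ((a , b) ∷ gs) = fromList gs [ a ↦ b ]

------------------------------------------------------------------------
-- Finite and infinite words

module Words (Letter : Set) where

  Word : Set
  Word = List Letter

  data Word∞ : Set where
    fin : Word → Word∞
    inf : (ℕ → Letter) → Word∞

  infix 4 _≈_
  data _≈_ : Word∞ → Word∞ → Set where
    fin : ∀ {u v} → u ≡ v → fin u ≈ fin v
    inf : ∀ {f g} → f ≗ g → inf f ≈ inf g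

  prepend : Word → (ℕ → Letter) → ℕ → Letter
  prepend []      g n       = g n
  prepend (a ∷ u) g zero    = a
  prepend (a ∷ u) g (suc n) = prepend u g n

  infixr 7 _++∞_
  _++∞_ : Word → Word∞ → Word∞
  u ++∞ fin v = fin (u ++ v)
  u ++∞ inf g = inf (prepend u g)

  infixr 7 _·_ _·∞_
  _·_ : Pred Word 0ℓ → Pred Word 0ℓ → Pred Word 0ℓ
  (U · V) w = ∃[ u ] ∃[ v ] U u × V v × w ≡ u ++ v

  _·∞_ : Pred Word 0ℓ → Pred Word∞ 0ℓ → Pred Word∞ 0ℓ
  (U ·∞ V) w = ∃[ u ] ∃[ v ] U u × V v × w ≈ u ++∞ v

  ｛ε｝ : Pred Word 0ℓ
  ｛ε｝ = ｛ [] ｝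

  -- A finite partial function T from K to 𝒫(Σ*): its finite domain, and the
  -- total map k ↦ T(k) with T(k) = ∅ outside the domain.
  record Eff (K : Set) : Set₁ where
    constructor eff
    field
      dom    : List K
      at     : K → Pred Word 0ℓ
      at⇒dom : ∀ {k w} → at k w → k ∈ dom

  open Eff public

  module _ {K : Set} where

    infix 4 _⊆ᵉ_
    _⊆ᵉ_ : Eff K → Eff K → Set
    T ⊆ᵉ T′ = ∀ k → at T k ⊆ at T′ k

    ∅ᵉ : Eff K
    ∅ᵉ = eff [] (λ _ _ → ⊥) (λ ())

    infix 8 _&_
    _&_ : K → Pred Word 0ℓ → Eff K
    k & U = eff [ k ] (λ k′ w → k′ ≡ k × U w) λ where (refl , _) → here refl

    infixr 6 _∪ᵉ_
    _∪ᵉ_ : Eff K → Eff K → Eff K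
    T ∪ᵉ T′ = eff (dom T ++ dom T′) (λ k → at T k ∪ at T′ k)
      λ where
        (inj₁ p) → ∈-++⁺ˡ (at⇒dom T p)
        (inj₂ p) → ∈-++⁺ʳ (dom T) (at⇒dom T′ p)

    infixr 7 _·ᵉ_
    _·ᵉ_ : Pred Word 0ℓ → Eff K → Eff K
    U ·ᵉ T = eff (dom T) (λ k → U · at T k) λ where
      (_ , _ , _ , p , _) → at⇒dom T p

    ⋃ᵉ : {I : Set} → List I → (I → Eff K) → Eff K
    ⋃ᵉ is T = eff (concatMap (dom ∘ T) is) (λ k w → ∃[ i ] i ∈ is × at (T i) k w) λ where
      (i , i∈ , p) → ∈-concatMap⁺ (dom ∘ T) (lose i∈ (at⇒dom (T i) p))

------------------------------------------------------------------------
-- Names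

record Names : Set₁ where
  field
    Letter         : Set
    letters-finite : ∃[ n ] (Letter ↔ Fin n)
    Var Cls Fld Mtd Pos Loc : Set
    _≟ᵛ_ : DecidableEquality Var
    _≟ᶜ_ : DecidableEquality Cls
    _≟ᶠ_ : DecidableEquality Fld
    _≟ᵐ_ : DecidableEquality Mtd
    _≟ᵖ_ : DecidableEquality Pos
    _≟ˡ_ : DecidableEquality Loc
    this            : Var
    Object NullType : Cls
    Object≢NullType : Object ≢ NullType

module Language (N : Names) where

  open Names N public
  open Words Letter public
  open DecMembership _≟ᶠ_ using () renaming (_∈?_ to _∈ᶠ?_)
  open Update _≟ᵛ_ public
    using () renaming (_[_↦_] to _[_↦_]ᵛ; fromList to fromListᵛ)
  open Update _≟ᶠ_ public
    using () renaming (_[_↦_] to _[_↦_]ᶠ)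
  open Update _≟ˡ_ public
    using () renaming (_[_↦_] to _[_↦_]ˡ)

  ----------------------------------------------------------------------
  -- Syntax

  -- In  call x C m ys ,  get x C f  and  set x C f y  the class C is the
  -- annotation of x.
  data Expr : Set where
    var   : Var → Expr
    let′  : Var → Expr → Expr → Expr
    if′   : Var → Var → Expr → Expr → Expr
    null′ : Expr
    new   : Pos → (C : Cls) → .(C ≢ NullType) → Expr
    cast  : (C : Cls) → .(C ≢ NullType) → Expr → Expr
    emit  : Letter → Expr
    call  : Var → Cls → Mtd → List Var → Expr
    get   : Var → Cls → Fld → Expr
    set   : Var → Cls → Fld → Var → Expr

  data ContainsNew (ℓ : Pos) (C : Cls) : Expr → Set where
    here  : ∀ .{C≢} → ContainsNew ℓ C (new ℓ C C≢)
    let₁  : ∀ {x e₁ e₂} → ContainsNew ℓ C e₁ → ContainsNew ℓ C (let′ x e₁ e₂)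
    let₂  : ∀ {x e₁ e₂} → ContainsNew ℓ C e₂ → ContainsNew ℓ C (let′ x e₁ e₂)
    then′ : ∀ {x y e₁ e₂} → ContainsNew ℓ C e₁ → ContainsNew ℓ C (if′ x y e₁ e₂)
    else′ : ∀ {x y e₁ e₂} → ContainsNew ℓ C e₂ → ContainsNew ℓ C (if′ x y e₁ e₂)
    cast  : ∀ {D e} .{D≢} → ContainsNew ℓ C e → ContainsNew ℓ C (cast D D≢ e)

  record Program : Set where
    field
      subclass : List (Cls × Cls)
      fields   : Cls → List Fld
      methods  : Cls → List Mtd
      mtable   : Cls → Mtd → Maybe (List Var × Expr)

    infix 4 _≺_ _⪯_
    _≺_ : Cls → Cls → Set
    C ≺ D = (C , D) ∈ subclass

    _⪯_ : Cls → Cls → Set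
    _⪯_ = Star _≺_

    arity : Cls → Mtd → ℕ
    arity C m = maybe′ (length ∘ proj₁) 0 (mtable C m)

    field
      -- The ≺-graph on the classes other than NullType is a tree with root
      -- Object: every class reaches Object along unique parents.
      ⪯-Object      : ∀ C → C ⪯ Object
      Object-root   : ∀ {C} → ¬ (Object ≺ C)
      parent-unique : ∀ {C D D′} → C ≢ NullType → C ≺ D → C ≺ D′ → D ≡ D′
      NullType-⪯    : ∀ C → NullType ⪯ C
      NullType-leaf : ∀ {C} → ¬ (C ≺ NullType)
      fields-⊆      : ∀ {C D} → C ⪯ D → C ≢ NullType → fields D ⊆ˡ fields C
      methods-⊆     : ∀ {C D} → C ⪯ D → C ≢ NullType → methods D ⊆ˡ methods C
      fields-Null   : fields NullType ≡ []
      methods-Null  : methods NullType ≡ []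
      mtable-dom    : ∀ C m → Is-just (mtable C m) ⇔ m ∈ methods C
      arity-inh     : ∀ {C D m} → C ⪯ D → C ≢ NullType → m ∈ methods D → arity C m ≡ arity D m

  -- [this ↦ a] ∪ [zᵢ ↦ aᵢ]ᵢ; on repeated names the first binding wins.
  bind : {A : Set} → A → List Var → List A → Var ⇀ A
  bind a zs as = fromListᵛ ((this , a) ∷ zip zs as)

  ----------------------------------------------------------------------
  -- Values, stores and heaps

  data Val : Set where
    null : Val
    loc  : Loc → Val

  record Obj : Set where
    constructor obj
    field
      cls  : Cls
      flds : Fld ⇀ Val
      pos  : Pos

  open Obj public

  Store Heap : Set
  Store = Var ⇀ Val
  Heap  = Loc ⇀ Obj

  data ClassOf (h : Heap) : Val → Cls → Set where
    null : ClassOf h null NullType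
    loc  : ∀ {l o} → h l ≡ just o → ClassOf h (loc l) (cls o)

  data Reg : Set where
    Null      : Reg
    CreatedAt : Pos → Reg
    Unknown   : Reg

  data Disjoint : Reg → Reg → Set where
    null-created    : ∀ {ℓ} → Disjoint Null (CreatedAt ℓ)
    created-null    : ∀ {ℓ} → Disjoint (CreatedAt ℓ) Null
    created-created : ∀ {ℓ ℓ′} → ℓ ≢ ℓ′ → Disjoint (CreatedAt ℓ) (CreatedAt ℓ′)

  Env Env₀ : Set
  Env  = Var ⇀ Reg
  Env₀ = Var ⇀ Cls

  module WithProgram (P : Program) where

    open Program P public

    newFields : Cls → (Fld ⇀ Val)
    newFields C f = if does (f ∈ᶠ? fields C) then just null else nothing

    infix 3 _,_⊢_⇓_,_&_
    data _,_⊢_⇓_,_&_ (s : Store) (h : Heap) : Expr → Val → Heap → Word → Set where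
      emit     : ∀ {a} → s , h ⊢ emit a ⇓ null , h & [ a ]
      var      : ∀ {x v} → s x ≡ just v → s , h ⊢ var x ⇓ v , h & []
      null     : s , h ⊢ null′ ⇓ null , h & []
      if-true  : ∀ {x y u e₁ e₂ v h′ w} → s x ≡ just u → s y ≡ just u →
                 s , h ⊢ e₁ ⇓ v , h′ & w →
                 s , h ⊢ if′ x y e₁ e₂ ⇓ v , h′ & w
      if-false : ∀ {x y u₁ u₂ e₁ e₂ v h′ w} → s x ≡ just u₁ → s y ≡ just u₂ → u₁ ≢ u₂ →
                 s , h ⊢ e₂ ⇓ v , h′ & w →
                 s , h ⊢ if′ x y e₁ e₂ ⇓ v , h′ & w
      let′     : ∀ {x e₁ e₂ v₁ h₁ w₁ v₂ h₂ w₂} →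
                 s , h ⊢ e₁ ⇓ v₁ , h₁ & w₁ →
                 (s [ x ↦ v₁ ]ᵛ) , h₁ ⊢ e₂ ⇓ v₂ , h₂ & w₂ →
                 s , h ⊢ let′ x e₁ e₂ ⇓ v₂ , h₂ & (w₁ ++ w₂)
      new      : ∀ {ℓ C l} .{C≢} → h l ≡ nothing →
                 s , h ⊢ new ℓ C C≢ ⇓ loc l , h [ l ↦ obj C (newFields C) ℓ ]ˡ & []
      cast     : ∀ {C e v h′ w D} .{C≢} → s , h ⊢ e ⇓ v , h′ & w →
                 ClassOf h′ v D → D ⪯ C →
                 s , h ⊢ cast C C≢ e ⇓ v , h′ & w
      get      : ∀ {x C f l o v} → s x ≡ just (loc l) → h l ≡ just o → flds o f ≡ just v →
                 s , h ⊢ get x C f ⇓ v , h & []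
      set      : ∀ {x C f y l o v} → s x ≡ just (loc l) → h l ≡ just o → s y ≡ just v →
                 s , h ⊢ set x C f y ⇓ v ,
                   h [ l ↦ obj (cls o) (flds o [ f ↦ v ]ᶠ) (pos o) ]ˡ & []
      call     : ∀ {x C m ys l o zs e vs v h′ w} →
                 s x ≡ just (loc l) → h l ≡ just o → mtable (cls o) m ≡ just (zs , e) →
                 length zs ≡ length ys → Pointwise (λ y u → s y ≡ just u) ys vs →
                 bind (loc l) zs vs , h ⊢ e ⇓ v , h′ & w →
                 s , h ⊢ call x C m ys ⇓ v , h′ & w

    DivRel : Set₁
    DivRel = Store → Heap → Expr → Word∞ → Set

    data DivStep (R : DivRel) (s : Store) (h : Heap) : Expr → Word∞ → Set where
      if-true  : ∀ {x y u e₁ e₂ w} → s x ≡ just u → s y ≡ just u →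
                 R s h e₁ w → DivStep R s h (if′ x y e₁ e₂) w
      if-false : ∀ {x y u₁ u₂ e₁ e₂ w} → s x ≡ just u₁ → s y ≡ just u₂ → u₁ ≢ u₂ →
                 R s h e₂ w → DivStep R s h (if′ x y e₁ e₂) w
      let₁     : ∀ {x e₁ e₂ w} → R s h e₁ w → DivStep R s h (let′ x e₁ e₂) w
      let₂     : ∀ {x e₁ e₂ v₁ h₁ w₁ w₂ w} → s , h ⊢ e₁ ⇓ v₁ , h₁ & w₁ →
                 R (s [ x ↦ v₁ ]ᵛ) h₁ e₂ w₂ → w ≈ w₁ ++∞ w₂ →
                 DivStep R s h (let′ x e₁ e₂) w
      cast     : ∀ {C e w} .{C≢} → R s h e w → DivStep R s h (cast C C≢ e) w
      call     : ∀ {x C m ys l o zs e vs w} →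
                 s x ≡ just (loc l) → h l ≡ just o → mtable (cls o) m ≡ just (zs , e) →
                 length zs ≡ length ys → Pointwise (λ y u → s y ≡ just u) ys vs →
                 R (bind (loc l) zs vs) h e w → DivStep R s h (call x C m ys) w

    -- The largest relation R with R ⊆ DivStep R, as the union of all such R.
    infix 3 _,_⊢_⇑&_
    _,_⊢_⇑&_ : Store → Heap → Expr → Word∞ → Set₁
    s , h ⊢ e ⇑& w = Σ[ R ∈ DivRel ]
      (∀ {s h e w} → R s h e w → DivStep R s h e w) × R s h e w

    --------------------------------------------------------------------
    -- Standard Featherweight Java typing, with classes as types

    FieldTyping : Set
    FieldTyping = Cls → Fld → Cls

    MethodTyping : Set
    MethodTyping = Cls → Mtd → List Cls × Cls

    module Standard (F₀ : FieldTyping) (M₀ : MethodTyping) where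

      -- The annotation of x in x^C is a class of x up to subsumption; hence an
      -- inherited body is also typable with  this  of the inheriting class.
      infix 3 _⊢₀_∶_
      data _⊢₀_∶_ (Γ : Env₀) : Expr → Cls → Set where
        sub  : ∀ {e C D} → Γ ⊢₀ e ∶ C → C ⪯ D → Γ ⊢₀ e ∶ D
        var  : ∀ {x C} → Γ x ≡ just C → Γ ⊢₀ var x ∶ C
        let′ : ∀ {x e₁ e₂ C D} → Γ ⊢₀ e₁ ∶ C → Γ [ x ↦ C ]ᵛ ⊢₀ e₂ ∶ D →
               Γ ⊢₀ let′ x e₁ e₂ ∶ D
        if′  : ∀ {x y e₁ e₂ C} → Is-just (Γ x) → Is-just (Γ y) →
               Γ ⊢₀ e₁ ∶ C → Γ ⊢₀ e₂ ∶ C → Γ ⊢₀ if′ x y e₁ e₂ ∶ C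
        null : Γ ⊢₀ null′ ∶ NullType
        new  : ∀ {ℓ C} .{C≢} → Γ ⊢₀ new ℓ C C≢ ∶ C
        cast : ∀ {e C D} .{C≢} → Γ ⊢₀ e ∶ D → Γ ⊢₀ cast C C≢ e ∶ C
        emit : ∀ {a} → Γ ⊢₀ emit a ∶ NullType
        get  : ∀ {x C f} → Γ ⊢₀ var x ∶ C → f ∈ fields C →
               Γ ⊢₀ get x C f ∶ F₀ C f
        set  : ∀ {x C f y E} → Γ ⊢₀ var x ∶ C → f ∈ fields C →
               Γ ⊢₀ var y ∶ E → E ⪯ F₀ C f → Γ ⊢₀ set x C f y ∶ E
        call : ∀ {x C m ys} → Γ ⊢₀ var x ∶ C → m ∈ methods C →
               Pointwise (λ y E → Γ ⊢₀ var y ∶ E) ys (proj₁ (M₀ C m)) →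
               Γ ⊢₀ call x C m ys ∶ proj₂ (M₀ C m)

      Conforms : Heap → Val → Cls → Set
      Conforms h v C = ∃[ D ] ClassOf h v D × D ⪯ C

      StoreConforms : Store → Heap → Env₀ → Set
      StoreConforms s h Γ = ∀ x C → Γ x ≡ just C → ∃[ v ] s x ≡ just v × Conforms h v C

      HeapConforms : Heap → Set
      HeapConforms h = ∀ l o → h l ≡ just o →
        cls o ≢ NullType ×
        (∀ f → f ∈ fields (cls o) → ∃[ v ] flds o f ≡ just v × Conforms h v (F₀ (cls o) f))

    -- F₀(C,f) and M₀(C,m) are only looked at for f ∈ fields C, m ∈ methods C.
    record StandardTyping : Set where
      field
        F₀ : FieldTyping
        M₀ : MethodTyping
      open Standard F₀ M₀ public
      field
        F₀-inh   : ∀ {C D f} → C ⪯ D → C ≢ NullType → f ∈ fields D → F₀ C f ≡ F₀ D f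
        M₀-inh   : ∀ {C D m} → C ⪯ D → C ≢ NullType → m ∈ methods D → M₀ C m ≡ M₀ D m
        M₀-arity : ∀ {C m} → m ∈ methods C → length (proj₁ (M₀ C m)) ≡ arity C m
        bodies   : ∀ {C m zs e} → mtable C m ≡ just (zs , e) →
                   bind C zs (proj₁ (M₀ C m)) ⊢₀ e ∶ proj₂ (M₀ C m)

    --------------------------------------------------------------------
    -- Regions, signatures and class tables

    ContainedNew : Pos → Cls → Set
    ContainedNew ℓ C =
      ∃[ D ] ∃[ m ] ∃[ zs ] ∃[ e ] mtable D m ≡ just (zs , e) × ContainsNew ℓ C e

    ClsOf : Reg → Pred Cls 0ℓ
    ClsOf Null          _ = ⊥
    ClsOf (CreatedAt ℓ) C = ContainedNew ℓ C
    ClsOf Unknown       _ = ⊤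

    infix 3 _,_⊨_
    data _,_⊨_ : Val → Heap → Reg → Set where
      null    : ∀ {h} → null , h ⊨ Null
      unknown : ∀ {v h} → v , h ⊨ Unknown
      created : ∀ {l h C G ℓ} → h l ≡ just (obj C G ℓ) → ClsOf (CreatedAt ℓ) C →
                loc l , h ⊨ CreatedAt ℓ

    record Sig : Set where
      constructor sig
      field
        σ-cls  : Cls
        σ-reg  : Reg
        σ-mtd  : Mtd
        σ-args : List Reg
        .σ-mtd∈  : σ-mtd ∈ methods σ-cls
        .σ-arity : length σ-args ≡ arity σ-cls σ-mtd

    infix 8 _⟦_⟧
    _⟦_⟧ : Eff Sig → (Sig → Pred Word∞ 0ℓ) → Pred Word∞ 0ℓ
    (S ⟦ η ⟧) w = ∃[ δ ] (at S δ ·∞ η δ) w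

    -- The domain of F is {(C,r,f) ∣ f ∈ fields C}; F C r f is not looked at
    -- elsewhere.
    record ClassTable : Set₁ where
      field
        F : Cls → Reg → Fld → Pred Reg 0ℓ
        M : Sig → Eff Reg × Eff Sig
        F-Null    : ∀ {C f} r → f ∈ fields C → F C r f Null
        F-Unknown : ∀ {C f} r → f ∈ fields C → F C r f ⊆ F C Unknown f
        F-inh     : ∀ {C D f} r → C ⪯ D → f ∈ fields C → f ∈ fields D → F C r f ≐ F D r f
        M-inh     : ∀ {C D r m rs} .(m∈C : m ∈ methods C) .(#C : length rs ≡ arity C m)
                    .(m∈D : m ∈ methods D) .(#D : length rs ≡ arity D m) → C ⪯ D →
                    proj₁ (M (sig C r m rs m∈C #C)) ⊆ᵉ proj₁ (M (sig D r m rs m∈D #D)) ×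
                    proj₂ (M (sig C r m rs m∈C #C)) ⊆ᵉ proj₂ (M (sig D r m rs m∈D #D))

    module WithTable (𝒯 : ClassTable) where

      open ClassTable 𝒯 public

      infix 3 _⊢_∶_calls_
      data _⊢_∶_calls_ (Γ : Env) : Expr → Eff Reg → Eff Sig → Set₁ where
        sub   : ∀ {e T T′ S S′} → Γ ⊢ e ∶ T calls S → T ⊆ᵉ T′ → S ⊆ᵉ S′ →
                Γ ⊢ e ∶ T′ calls S′
        weak  : ∀ {e r U T S} → Γ ⊢ e ∶ r & U ∪ᵉ T calls S →
                Γ ⊢ e ∶ Unknown & U ∪ᵉ T calls S
        prim  : ∀ {a} → Γ ⊢ emit a ∶ Null & ｛ [ a ] ｝ calls ∅ᵉ
        null  : Γ ⊢ null′ ∶ Null & ｛ε｝ calls ∅ᵉ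
        new   : ∀ {ℓ C} .{C≢} → Γ ⊢ new ℓ C C≢ ∶ CreatedAt ℓ & ｛ε｝ calls ∅ᵉ
        var   : ∀ {x r} → Γ x ≡ just r → Γ ⊢ var x ∶ r & ｛ε｝ calls ∅ᵉ
        if′   : ∀ {x y e₁ e₂ T₁ T₂ S₁ S₂} → Is-just (Γ x) → Is-just (Γ y) →
                Γ ⊢ e₁ ∶ T₁ calls S₁ → Γ ⊢ e₂ ∶ T₂ calls S₂ →
                Γ ⊢ if′ x y e₁ e₂ ∶ T₁ ∪ᵉ T₂ calls S₁ ∪ᵉ S₂
        else′ : ∀ {x y r₁ r₂ e₁ e₂ T₂ S₂} → Γ x ≡ just r₁ → Γ y ≡ just r₂ → Disjoint r₁ r₂ →
                Γ ⊢ e₂ ∶ T₂ calls S₂ →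
                Γ ⊢ if′ x y e₁ e₂ ∶ T₂ calls S₂
        let′  : ∀ {x e₁ e₂ T₁ S₁} {T : Reg → Eff Reg} {S : Reg → Eff Sig} →
                Γ ⊢ e₁ ∶ T₁ calls S₁ →
                (∀ {r} → r ∈ dom T₁ → Γ [ x ↦ r ]ᵛ ⊢ e₂ ∶ T r calls S r) →
                Γ ⊢ let′ x e₁ e₂ ∶ ⋃ᵉ (dom T₁) (λ r → at T₁ r ·ᵉ T r)
                  calls S₁ ∪ᵉ ⋃ᵉ (dom T₁) (λ r → at T₁ r ·ᵉ S r)
        cast  : ∀ {D e T S} .{D≢} → Γ ⊢ e ∶ T calls S → Γ ⊢ cast D D≢ e ∶ T calls S
        -- The conclusion must be a finite partial function, whence the
        -- enumeration rs of F(C,r,f).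
        get   : ∀ {x C f r} (rs : List Reg) → Γ x ≡ just r → f ∈ fields C →
                (∀ r′ → r′ ∈ rs ⇔ F C r f r′) →
                Γ ⊢ get x C f ∶ ⋃ᵉ rs (_& ｛ε｝) calls ∅ᵉ
        -- The premise on r ≡ Unknown is not part of the usual rule, which is
        -- unsound without it: from F(A,CreatedAt(0),f) = {Null} and
        -- F(A,Unknown,f) = {Null,CreatedAt(1)}, weakening the alias z to Unknown
        -- in  let x = new⁰ A in let y = new¹ A in let z = x in
        -- let d = (z.f := y) in x.f  would give region Null to a location.
        set   : ∀ {x C f y r r′} → Γ x ≡ just r → Γ y ≡ just r′ → f ∈ fields C →
                F C r f r′ →
                (r ≡ Unknown → ∀ {ℓ D} → ClsOf (CreatedAt ℓ) D → D ⪯ C → F D (CreatedAt ℓ) f r′) →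
                Γ ⊢ set x C f y ∶ r′ & ｛ε｝ calls ∅ᵉ
        call  : ∀ {x C m ys r rs} → Γ x ≡ just r → Pointwise (λ y r′ → Γ y ≡ just r′) ys rs →
                .(m∈ : m ∈ methods C) .(# : length rs ≡ arity C m) →
                let δ = sig C r m rs m∈ # in
                Γ ⊢ call x C m ys ∶ proj₁ (M δ) calls δ & ｛ε｝

      WellTyped : Set₁
      WellTyped = ∀ {C r m rs zs e} .(m∈ : m ∈ methods C) .(# : length rs ≡ arity C m) →
        ClsOf r C → mtable C m ≡ just (zs , e) →
        let T , S = M (sig C r m rs m∈ #) in
        bind r zs rs ⊢ e ∶ T calls S

      Solution : (Sig → Pred Word∞ 0ℓ) → Set
      Solution η = ∀ δ → η δ ≐ proj₂ (M δ) ⟦ η ⟧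

      record InfinitaryEffectTyping (η : Sig → Pred Word∞ 0ℓ) : Set₁ where
        field
          solution : Solution η
          greatest : ∀ η′ → Solution η′ → ∀ δ → η′ δ ⊆ η δ

      infix 3 _,_⊨ᵉ_ _⊨F
      _,_⊨ᵉ_ : Store → Heap → Env → Set
      s , h ⊨ᵉ Γ = ∀ x r → Γ x ≡ just r → ∃[ v ] s x ≡ just v × (v , h ⊨ r)

      -- F(C,r,f) constrains the objects of class C in region r; demanding
      -- (G(f),h) ⊢ F(C,r,f) for objects outside r as well would not be
      -- preserved by writes.
      _⊨F : Heap → Set
      h ⊨F = ∀ l o → h l ≡ just o → ∀ r f → f ∈ fields (cls o) → loc l , h ⊨ r →
        ∃[ v ] flds o f ≡ just v × (∃[ r′ ] F (cls o) r f r′ × (v , h ⊨ r′))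

{-# OPTIONS --safe #-}
module Submission where

-- Part (1) is an induction on the evaluation, nested with one on the typing derivation.
-- At a call, the class D of the receiver is, by the standard typing, a subclass of the
-- annotation C, so the body is typed by the entry of M for D, which is contained in the
-- one for C.
--
-- For part (2), let X δ be the set of words of diverging runs of bodies that δ may invoke.
-- Descending through a diverging expression meets a call after finitely many steps, the
-- word emitted before it being controlled by (1); hence X δ ⊆ S_δ(X). As every monomial
-- U·δ contains a single signature, unfolding this inclusion gives a sequence of
-- signatures, and such sequences form a solution, hence are below η.

open import Data.Product using (∃-syntax; _×_)
open import Data.List.Membership.Propositional using (_∈_)
open import Defs

open import Data.Empty using (⊥-elim)
open import Data.List.Base using (List; []; _∷_; _++_; length; zip)
import Data.List.Membership.DecPropositional as DecMembership
open import Data.List.Properties using (++-assoc)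
open import Data.List.Relation.Binary.Pointwise as Pointwise
  using (Pointwise; []; _∷_; Pointwise-length)
open import Data.Maybe using (just; maybe′; Is-just)
open import Data.Maybe.Properties using (just-injective)
open import Data.Maybe.Relation.Unary.Any using (just)
open import Data.Nat.Base using (ℕ; zero; suc)
open import Data.Product using (_,_; proj₁; proj₂)
open import Data.Sum.Base using (_⊎_; inj₁; inj₂)
open import Data.Unit.Base using (tt)
open import Function.Base using (_∘_; id; case_of_)
open import Function.Bundles using (Equivalence)
open import Level using (0ℓ)
open import Relation.Binary.Construct.Closure.ReflexiveTransitive using (ε; _◅◅_)
open import Relation.Binary.Definitions using (DecidableEquality)
open import Relation.Binary.PropositionalEquality
  using (_≡_; _≢_; refl; sym; trans; cong; subst)
open import Relation.Nullary using (yes; no; ¬?)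
open import Relation.Nullary.Decidable using (dec-true; recompute)
open import Relation.Unary using (Pred; _⊆_)

-- Agreement of partial maps under update.

module UpdateProperties {A : Set} (_≟_ : DecidableEquality A) where

  open Update _≟_

  module _ {B : Set} (g : A ⇀ B) {a : A} {b : B} where

    update-at : (g [ a ↦ b ]) a ≡ just b
    update-at rewrite dec-true (a ≟ a) refl = refl

    update⁻ : ∀ {a′ c} → (g [ a ↦ b ]) a′ ≡ just c →
              (a′ ≡ a × c ≡ b) ⊎ (a′ ≢ a × g a′ ≡ just c)
    update⁻ {a′} eq with a′ ≟ a
    ... | yes a′≡a = inj₁ (a′≡a , sym (just-injective eq))
    ... | no  a′≢a = inj₂ (a′≢a , eq)

  -- Both `_,_⊨ᵉ_` and `StoreConforms` unfold to instances of this, so one set of lemmas serves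
  -- region and class environments.
  Agree : {B C : Set} → (B → C → Set) → (A ⇀ B) → (A ⇀ C) → Set
  Agree ρ s Γ = ∀ x c → Γ x ≡ just c → ∃[ b ] s x ≡ just b × ρ b c

  module _ {B C : Set} {ρ : B → C → Set} where

    update-agree : ∀ {s Γ x b c} → ρ b c → Agree ρ s Γ → Agree ρ (s [ x ↦ b ]) (Γ [ x ↦ c ])
    update-agree {x = x} ρbc agr y c′ eq with y ≟ x | eq
    ... | yes _ | refl = _ , refl , ρbc
    ... | no  _ | eq′  = agr y c′ eq′

    fromList-agree : ∀ zs {bs cs} → Pointwise ρ bs cs →
                     Agree ρ (fromList (zip zs bs)) (fromList (zip zs cs))
    fromList-agree []       ps       = λ _ _ ()
    fromList-agree (z ∷ zs) []       = λ _ _ ()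
    fromList-agree (z ∷ zs) (p ∷ ps) = update-agree p (fromList-agree zs ps)

-- Concatenation of finite and infinite words.

module WordProperties (Letter : Set) where

  open Words Letter

  ≈-trans : ∀ {u v w} → u ≈ v → v ≈ w → u ≈ w
  ≈-trans (fin p) (fin q) = fin (trans p q)
  ≈-trans (inf p) (inf q) = inf λ n → trans (p n) (q n)

  prepend-cong : ∀ u {f g} → (∀ n → f n ≡ g n) → ∀ n → prepend u f n ≡ prepend u g n
  prepend-cong []      p n       = p n
  prepend-cong (a ∷ u) p zero    = refl
  prepend-cong (a ∷ u) p (suc n) = prepend-cong u p n

  prepend-++ : ∀ u v g n → prepend u (prepend v g) n ≡ prepend (u ++ v) g n
  prepend-++ []      v g n       = refl
  prepend-++ (a ∷ u) v g zero    = refl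
  prepend-++ (a ∷ u) v g (suc n) = prepend-++ u v g n

  ++∞-congʳ : ∀ u {v w} → v ≈ w → u ++∞ v ≈ u ++∞ w
  ++∞-congʳ u (fin p) = fin (cong (u ++_) p)
  ++∞-congʳ u (inf p) = inf (prepend-cong u p)

  []-++∞ : ∀ w → w ≈ [] ++∞ w
  []-++∞ (fin _) = fin refl
  []-++∞ (inf _) = inf λ _ → refl

  ++∞-assoc : ∀ u v w → u ++∞ v ++∞ w ≈ (u ++ v) ++∞ w
  ++∞-assoc u v (fin w) = fin (sym (++-assoc u v w))
  ++∞-assoc u v (inf g) = inf (prepend-++ u v g)

-- Heap growth under evaluation, and region satisfaction.

module Evaluation (N : Names) (P : Language.Program N) where

  open Language N
  open WithProgram P
  open DecMembership _≟ᶠ_ using () renaming (_∈?_ to _∈ᶠ?_)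
  open UpdateProperties _≟ˡ_ using ()
    renaming (update-at to update-atˡ; update⁻ to updateˡ⁻)

  infix 4 _≲_
  -- Class and creation label stay fixed once an object exists, and region satisfaction and
  -- `Conforms` look at nothing else in it.
  _≲_ : Obj → Obj → Set
  o ≲ o′ = cls o ≡ cls o′ × pos o ≡ pos o′

  infix 4 _⊑_
  record _⊑_ (h h′ : Heap) : Set where
    constructor extends
    field
      lookup : ∀ {l o} → h l ≡ just o → ∃[ o′ ] h′ l ≡ just o′ × o ≲ o′

  open _⊑_

  ⊑-refl : ∀ {h} → h ⊑ h
  ⊑-refl = extends λ eq → _ , eq , refl , refl

  ⊑-trans : ∀ {h₁ h₂ h₃} → h₁ ⊑ h₂ → h₂ ⊑ h₃ → h₁ ⊑ h₃
  ⊑-trans p q = extends λ eq →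
    let _ , eq₁ , c₁ , p₁ = lookup p eq
        _ , eq₂ , c₂ , p₂ = lookup q eq₁
    in _ , eq₂ , trans c₁ c₂ , trans p₁ p₂

  ⊑-update : ∀ {h l o′} → (∀ {o} → h l ≡ just o → o ≲ o′) → h ⊑ h [ l ↦ o′ ]ˡ
  ⊑-update {h} {l} {o′} same = extends found
    where
    found : ∀ {l′ o} → h l′ ≡ just o → ∃[ o″ ] (h [ l ↦ o′ ]ˡ) l′ ≡ just o″ × o ≲ o″
    found {l′} eq with l′ ≟ˡ l
    ... | yes refl = _ , refl , same eq
    ... | no  _    = _ , eq , refl , refl

  -- The heap is written in two cases only: `new` fills an undefined location, where the condition
  -- of `⊑-update` is vacuous, and `set` keeps class and label.
  eval-⊑ : ∀ {s h e v h′ w} → s , h ⊢ e ⇓ v , h′ & w → h ⊑ h′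
  eval-⊑ emit               = ⊑-refl
  eval-⊑ (var _)            = ⊑-refl
  eval-⊑ null               = ⊑-refl
  eval-⊑ (if-true _ _ d)    = eval-⊑ d
  eval-⊑ (if-false _ _ _ d) = eval-⊑ d
  eval-⊑ (let′ d₁ d₂)       = ⊑-trans (eval-⊑ d₁) (eval-⊑ d₂)
  eval-⊑ (new fresh)        = ⊑-update λ eq → case trans (sym fresh) eq of λ ()
  eval-⊑ (cast d _ _)       = eval-⊑ d
  eval-⊑ (get _ _ _)        = ⊑-refl
  eval-⊑ (set _ hl _)       = ⊑-update λ eq → case trans (sym hl) eq of λ { refl → refl , refl }
  eval-⊑ (call _ _ _ _ _ d) = eval-⊑ d

  newFields-null : ∀ {C f} → f ∈ fields C → newFields C f ≡ just null
  newFields-null {C} {f} f∈ rewrite dec-true (f ∈ᶠ? fields C) f∈ = refl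

  ⊨-transport : ∀ {h h′ l o o′ r} → h l ≡ just o → h′ l ≡ just o′ → o ≲ o′ →
                loc l , h ⊨ r → loc l , h′ ⊨ r
  ⊨-transport hl h′l (refl , refl) unknown = unknown
  ⊨-transport hl h′l (refl , refl) (created hl′ C∈)
    with refl ← trans (sym hl) hl′ = created h′l C∈

  ⊨-mono : ∀ {h h′ v r} → h ⊑ h′ → v , h ⊨ r → v , h′ ⊨ r
  ⊨-mono h⊑ null    = null
  ⊨-mono h⊑ unknown = unknown
  ⊨-mono h⊑ p@(created hl _) with _ , h′l , o≲ ← lookup h⊑ hl = ⊨-transport hl h′l o≲ p

  -- Supplies the premise `ClsOf r C` of `WellTyped` for the dynamic class of a receiver.
  ⊨-ClsOf : ∀ {h l o r} → h l ≡ just o → loc l , h ⊨ r → ClsOf r (cls o)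
  ⊨-ClsOf hl unknown = tt
  ⊨-ClsOf hl (created hl′ C∈) with refl ← trans (sym hl) hl′ = C∈

  -- `Null` holds only `null`, and an object carries a single creation label. The arbitrary
  -- conclusion disposes of the then-branch under rule `else′`.
  ⊨-disjoint : ∀ {h v r r′} → v , h ⊨ r → v , h ⊨ r′ → Disjoint r r′ → ∀ {A : Set} → A
  ⊨-disjoint null () null-created
  ⊨-disjoint (created hl _) (created hl′ _) (created-created ℓ≢)
    with refl ← trans (sym hl) hl′ = ⊥-elim (ℓ≢ refl)

  -- Type preservation for the standard class typing.

  module Preservation (J : StandardTyping) where

    open StandardTyping J
    open UpdateProperties _≟ᵛ_ using ()
      renaming (update-agree to update-agreeᵛ; fromList-agree to fromList-agreeᵛ)

    Conforms-mono : ∀ {h h′ v C} → h ⊑ h′ → Conforms h v C → Conforms h′ v C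
    Conforms-mono h⊑ (_ , null , D⪯) = _ , null , D⪯
    Conforms-mono {C = C} h⊑ (_ , loc hl , D⪯) with _ , h′l , c≡ , _ ← lookup h⊑ hl =
      _ , loc h′l , subst (_⪯ C) c≡ D⪯

    Conforms-⪯ : ∀ {h v C D} → Conforms h v C → C ⪯ D → Conforms h v D
    Conforms-⪯ (E , c , E⪯) C⪯ = E , c , E⪯ ◅◅ C⪯

    Conforms-null : ∀ {h C} → Conforms h null C
    Conforms-null = _ , null , NullType-⪯ _

    Conforms-loc⁻ : ∀ {h l o C} → h l ≡ just o → Conforms h (loc l) C → cls o ⪯ C
    Conforms-loc⁻ hl (_ , loc hl′ , D⪯) with refl ← trans (sym hl) hl′ = D⪯

    StoreConforms-mono : ∀ {s h h′ Γ₀} → h ⊑ h′ → StoreConforms s h Γ₀ → StoreConforms s h′ Γ₀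
    StoreConforms-mono h⊑ sc x C eq with v , sx , c ← sc x C eq = v , sx , Conforms-mono h⊑ c

    var-conforms : ∀ {Γ₀ s h x v C} → Γ₀ ⊢₀ var x ∶ C → StoreConforms s h Γ₀ →
                   s x ≡ just v → Conforms h v C
    var-conforms (sub d C⪯) sc sx = Conforms-⪯ (var-conforms d sc sx) C⪯
    var-conforms (var Γx) sc sx with sc _ _ Γx
    ... | _ , sx′ , c with refl ← trans (sym sx) sx′ = c

    -- `sound` recurses on the region derivation, so the standard derivation of the same expression
    -- is taken apart separately, through whatever `sub` steps it ends in.
    let-inv : ∀ {Γ₀ x e₁ e₂ D} → Γ₀ ⊢₀ let′ x e₁ e₂ ∶ D →
              ∃[ C ] Γ₀ ⊢₀ e₁ ∶ C × Γ₀ [ x ↦ C ]ᵛ ⊢₀ e₂ ∶ D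
    let-inv (sub d D⪯) with C , d₁ , d₂ ← let-inv d = C , d₁ , sub d₂ D⪯
    let-inv (let′ d₁ d₂) = _ , d₁ , d₂

    if-inv : ∀ {Γ₀ x y e₁ e₂ C} → Γ₀ ⊢₀ if′ x y e₁ e₂ ∶ C → Γ₀ ⊢₀ e₁ ∶ C × Γ₀ ⊢₀ e₂ ∶ C
    if-inv (sub d C⪯) with d₁ , d₂ ← if-inv d = sub d₁ C⪯ , sub d₂ C⪯
    if-inv (if′ _ _ d₁ d₂) = d₁ , d₂

    cast-inv : ∀ {Γ₀ C e E} .{C≢} → Γ₀ ⊢₀ cast C C≢ e ∶ E → ∃[ D ] Γ₀ ⊢₀ e ∶ D
    cast-inv (sub d _) = cast-inv d
    cast-inv (cast d)  = _ , d

    get-inv : ∀ {Γ₀ x C f E} → Γ₀ ⊢₀ get x C f ∶ E → Γ₀ ⊢₀ var x ∶ C × f ∈ fields C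
    get-inv (sub d _)   = get-inv d
    get-inv (get d f∈) = d , f∈

    set-inv : ∀ {Γ₀ x C f y E} → Γ₀ ⊢₀ set x C f y ∶ E → Γ₀ ⊢₀ var x ∶ C
    set-inv (sub d _)     = set-inv d
    set-inv (set d _ _ _) = d

    call-inv : ∀ {Γ₀ x C m ys E} → Γ₀ ⊢₀ call x C m ys ∶ E →
               Γ₀ ⊢₀ var x ∶ C × m ∈ methods C ×
               Pointwise (λ y D → Γ₀ ⊢₀ var y ∶ D) ys (proj₁ (M₀ C m))
    call-inv (sub d _)      = call-inv d
    call-inv (call d m∈ ds) = d , m∈ , ds

    HeapConforms-update : ∀ {h l o} → h ⊑ h [ l ↦ o ]ˡ → cls o ≢ NullType →
      (∀ f → f ∈ fields (cls o) →
        ∃[ v ] flds o f ≡ just v × Conforms (h [ l ↦ o ]ˡ) v (F₀ (cls o) f)) →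
      HeapConforms h → HeapConforms (h [ l ↦ o ]ˡ)
    HeapConforms-update {h} h⊑ o≢ fs hc l′ o′ eq with updateˡ⁻ h eq
    ... | inj₁ (refl , refl) = o≢ , fs
    ... | inj₂ (_ , hl′) with o′≢ , fs′ ← hc l′ o′ hl′ = o′≢ , λ f f∈ →
      let v , Gf , c = fs′ f f∈ in v , Gf , Conforms-mono h⊑ c

    -- In `conforms`, `this` has the dynamic class `cls o` rather than the annotation `C`, because
    -- that is how `bodies` types the method that dispatch selects.
    record Activation (C : Cls) (m : Mtd) (h : Heap) (l : Loc) (o : Obj)
                      (zs : List Var) (vs : List Val) : Set where
      field
        D⪯C       : cls o ⪯ C
        m∈D       : m ∈ methods (cls o)
        signature : M₀ (cls o) m ≡ M₀ C m
        conforms  : StoreConforms (bind (loc l) zs vs) h (bind (cls o) zs (proj₁ (M₀ (cls o) m)))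

    activate : ∀ {Γ₀ s h x C m ys l o zs e vs} → Γ₀ ⊢₀ var x ∶ C → m ∈ methods C →
      Pointwise (λ y D → Γ₀ ⊢₀ var y ∶ D) ys (proj₁ (M₀ C m)) →
      StoreConforms s h Γ₀ → HeapConforms h →
      s x ≡ just (loc l) → h l ≡ just o → mtable (cls o) m ≡ just (zs , e) →
      Pointwise (λ y u → s y ≡ just u) ys vs → Activation C m h l o zs vs
    activate {C = C} {m} {o = o} {zs} d m∈ ds sc hc sx hl mt args = record
      { D⪯C       = D⪯C
      ; m∈D       = Equivalence.to (mtable-dom _ _) (subst Is-just (sym mt) (just tt))
      ; signature = same
      ; conforms  = update-agreeᵛ (_ , loc hl , ε) (fromList-agreeᵛ zs conf)
      }
      where
      D⪯C  = Conforms-loc⁻ hl (var-conforms d sc sx)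
      -- `M₀-inh` excludes `NullType`, which is never the class of an object in a conforming heap.
      same = M₀-inh D⪯C (proj₁ (hc _ _ hl)) m∈
      conf = subst (Pointwise _ _) (cong proj₁ (sym same))
        (Pointwise.transitive (λ sy dy → var-conforms dy sc sy) (Pointwise.symmetric id args) ds)

    -- Lexicographic recursion on the evaluation, then the typing: `sub` keeps the former and
    -- shortens the latter, while `call` takes a fresh typing from `bodies` with a shorter
    -- evaluation.
    preserve : ∀ {Γ₀ e C s h v h′ w} → Γ₀ ⊢₀ e ∶ C → StoreConforms s h Γ₀ → HeapConforms h →
               s , h ⊢ e ⇓ v , h′ & w → HeapConforms h′ × Conforms h′ v C
    preserve (sub d C⪯) sc hc ev with hc′ , c ← preserve d sc hc ev = hc′ , Conforms-⪯ c C⪯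
    preserve d@(var _) sc hc (var sx) = hc , var-conforms d sc sx
    preserve (let′ d₁ d₂) sc hc (let′ ev₁ ev₂) with hc₁ , c₁ ← preserve d₁ sc hc ev₁ =
      preserve d₂ (update-agreeᵛ c₁ (StoreConforms-mono (eval-⊑ ev₁) sc)) hc₁ ev₂
    preserve (if′ _ _ d₁ d₂) sc hc (if-true _ _ ev)    = preserve d₁ sc hc ev
    preserve (if′ _ _ d₁ d₂) sc hc (if-false _ _ _ ev) = preserve d₂ sc hc ev
    preserve null sc hc null = hc , Conforms-null
    preserve {h = h} (new {C = C} {C≢}) sc hc ev@(new _) =
      -- The proof stored in the syntax is irrelevant; decidable equality of classes recovers a
      -- relevant one.
      HeapConforms-update (eval-⊑ ev) (recompute (¬? (C ≟ᶜ NullType)) C≢)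
        (λ f f∈ → null , newFields-null f∈ , Conforms-null) hc ,
      _ , loc (update-atˡ h) , ε
    preserve (cast d) sc hc (cast ev D D⪯) with hc′ , _ ← preserve d sc hc ev = hc′ , _ , D , D⪯
    preserve emit sc hc emit = hc , Conforms-null
    preserve (get d f∈) sc hc (get sx hl Gf)
      with D⪯C ← Conforms-loc⁻ hl (var-conforms d sc sx) | o≢ , fs ← hc _ _ hl
      with fs _ (fields-⊆ D⪯C o≢ f∈)
    ... | _ , Gf′ , c with refl ← trans (sym Gf) Gf′ =
      hc , subst (Conforms _ _) (F₀-inh D⪯C o≢ f∈) c
    preserve (set {f = f} d f∈ dy E⪯) sc hc ev@(set {o = o} {v = v} sx hl sy)
      with D⪯C ← Conforms-loc⁻ hl (var-conforms d sc sx) | o≢ , fs ← hc _ _ hl =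
      HeapConforms-update (eval-⊑ ev) o≢ written hc , c
      where
      c = Conforms-mono (eval-⊑ ev) (var-conforms dy sc sy)
      written : ∀ f′ → f′ ∈ fields (cls o) →
                ∃[ v′ ] (flds o [ f ↦ v ]ᶠ) f′ ≡ just v′ × Conforms _ v′ (F₀ (cls o) f′)
      written f′ f′∈ with f′ ≟ᶠ f
      ... | yes refl = _ , refl ,
        subst (Conforms _ _) (sym (F₀-inh D⪯C o≢ f∈)) (Conforms-⪯ c E⪯)
      ... | no _ with v′ , Gf , c′ ← fs f′ f′∈ = v′ , Gf , Conforms-mono (eval-⊑ ev) c′
    preserve (call d m∈ ds) sc hc (call sx hl mt _ args ev) =
      let act     = activate d m∈ ds sc hc sx hl mt args
          hc′ , c = preserve (bodies mt) (Activation.conforms act) hc ev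
      in hc′ , subst (Conforms _ _) (cong proj₂ (Activation.signature act)) c

    -- Region and effect soundness of terminating runs.

    module Soundness (𝒯 : ClassTable) (wellTyped : WithTable.WellTyped 𝒯) where

      open WithTable 𝒯
      open WordProperties Letter

      -- `CreatedAt ℓ` admits a class only if some method body contains the matching `new`, so each
      -- `new` that is evaluated must stem from the program.
      Contained : Expr → Set
      Contained e = ∀ ℓ C → ContainsNew ℓ C e → ContainedNew ℓ C

      -- The standard invariants accompany the region ones because region typing alone does not
      -- relate an annotation to the class of the object met at run time.
      record Ok (Γ : Env) (Γ₀ : Env₀) (s : Store) (h : Heap) : Set where
        constructor mkOk
        field
          store  : s , h ⊨ᵉ Γ
          heap   : h ⊨F
          store₀ : StoreConforms s h Γ₀
          heap₀  : HeapConforms h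

      open Ok

      ⊨ᵉ-mono : ∀ {Γ s h h′} → h ⊑ h′ → s , h ⊨ᵉ Γ → s , h′ ⊨ᵉ Γ
      ⊨ᵉ-mono h⊑ st x r eq with v , sx , p ← st x r eq = v , sx , ⊨-mono h⊑ p

      lookup-⊨ : ∀ {Γ s h x r v} → s , h ⊨ᵉ Γ → Γ x ≡ just r → s x ≡ just v → v , h ⊨ r
      lookup-⊨ st Γx sx with st _ _ Γx
      ... | _ , sx′ , p with refl ← trans (sym sx) sx′ = p

      ⊨F-update : ∀ {h l o} → h ⊑ h [ l ↦ o ]ˡ →
        (∀ r f → f ∈ fields (cls o) → loc l , h [ l ↦ o ]ˡ ⊨ r →
          ∃[ v ] flds o f ≡ just v × (∃[ r′ ] F (cls o) r f r′ × (v , h [ l ↦ o ]ˡ ⊨ r′))) →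
        h ⊨F → h [ l ↦ o ]ˡ ⊨F
      ⊨F-update {h} h⊑ fs hF l′ o′ eq r f f∈ p with updateˡ⁻ h eq
      ... | inj₁ (refl , refl) = fs r f f∈ p
      ... | inj₂ (_ , hl′)
        -- The region of the object is carried back to the old heap, that of the field value forward
        -- to the new one.
        with v , Gf , r′ , r′∈ , q ← hF l′ o′ hl′ r f f∈ (⊨-transport eq hl′ (refl , refl) p) =
        v , Gf , r′ , r′∈ , ⊨-mono h⊑ q

      -- A region q of the written object is r itself, or Unknown, or some CreatedAt(ℓ) with
      -- r = Unknown; the last case is what the extra premise of (set) is for.
      written-region : ∀ {h l o C r r′ f} → h l ≡ just o → cls o ⪯ C →
        f ∈ fields (cls o) → f ∈ fields C → F C r f r′ →
        (r ≡ Unknown → ∀ {ℓ D} → ClsOf (CreatedAt ℓ) D → D ⪯ C → F D (CreatedAt ℓ) f r′) →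
        loc l , h ⊨ r → ∀ {q} → loc l , h ⊨ q → F (cls o) q f r′
      written-region hl D⪯C f∈D f∈C r′∈ ext p unknown =
        proj₂ (F-inh _ D⪯C f∈D f∈C) (F-Unknown _ f∈C r′∈)
      written-region hl D⪯C f∈D f∈C r′∈ ext (created hl₁ _) (created hl₂ _)
        with refl ← trans (sym hl₁) hl₂ = proj₂ (F-inh _ D⪯C f∈D f∈C) r′∈
      written-region hl D⪯C f∈D f∈C r′∈ ext unknown q@(created _ _) =
        ext refl (⊨-ClsOf hl q) D⪯C

      record RegionActivation (r : Reg) (m : Mtd) (rs : List Reg) (h : Heap) (l : Loc) (o : Obj)
                              (zs : List Var) (e : Expr) (vs : List Val) : Set where
        field
          D∈r       : ClsOf r (cls o)
          #D        : length rs ≡ arity (cls o) m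
          contained : Contained e
          store     : bind (loc l) zs vs , h ⊨ᵉ bind r zs rs

      regionActivate : ∀ {Γ s h x m ys r rs l o zs e vs} → s , h ⊨ᵉ Γ →
        Γ x ≡ just r → Pointwise (λ y r′ → Γ y ≡ just r′) ys rs →
        s x ≡ just (loc l) → h l ≡ just o → mtable (cls o) m ≡ just (zs , e) →
        length zs ≡ length ys → Pointwise (λ y u → s y ≡ just u) ys vs →
        RegionActivation r m rs h l o zs e vs
      regionActivate {zs = zs} st Γx Γys sx hl mt len args = record
        { D∈r       = ⊨-ClsOf hl p
        -- The call rule of the evaluation compares `ys` with `zs`, the parameters recorded for
        -- `cls o`; this gives the arity there.
        ; #D        = trans (sym (Pointwise-length Γys))
                        (trans (sym len) (cong (maybe′ (length ∘ proj₁) 0) (sym mt)))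
        ; contained = λ _ _ c → _ , _ , _ , _ , mt , c
        ; store     = update-agreeᵛ p (fromList-agreeᵛ zs
                        (Pointwise.transitive (λ sy Γy → lookup-⊨ st Γy sy)
                          (Pointwise.symmetric id args) Γys))
        }
        where p = lookup-⊨ st Γx sx

      Result : Heap → Val → Eff Reg → Word → Set
      Result h v T w = ∃[ r ] (v , h ⊨ r) × at T r w

      extend : ∀ {Γ Γ₀ s h h′ x r C v} → h ⊑ h′ → Ok Γ Γ₀ s h → h′ ⊨F → HeapConforms h′ →
               v , h′ ⊨ r → Conforms h′ v C → Ok (Γ [ x ↦ r ]ᵛ) (Γ₀ [ x ↦ C ]ᵛ) (s [ x ↦ v ]ᵛ) h′
      extend h⊑ ok hF hc p c =
        mkOk (update-agreeᵛ p (⊨ᵉ-mono h⊑ (store ok))) hF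
             (update-agreeᵛ c (StoreConforms-mono h⊑ (store₀ ok))) hc

      -- Recursion as in `preserve`, with the region derivation in second place. The claim about `Γ`
      -- is left to `⊨ᵉ-mono`, as evaluation keeps the store.
      sound : ∀ {Γ Γ₀ e T S C₀ s h v h′ w} → Γ ⊢ e ∶ T calls S → Contained e → Γ₀ ⊢₀ e ∶ C₀ →
              Ok Γ Γ₀ s h → s , h ⊢ e ⇓ v , h′ & w → h′ ⊨F × Result h′ v T w

      -- The region given to `x` is one under which `T₁` records `w₁`; it selects the premise of
      -- `let′` for `e₂`, whether `e₂` terminates or diverges.
      extendLet : ∀ {Γ Γ₀ x e₁ T₁ S₁ C s h v₁ h₁ w₁} → Γ ⊢ e₁ ∶ T₁ calls S₁ → Contained e₁ →
        Γ₀ ⊢₀ e₁ ∶ C → Ok Γ Γ₀ s h → s , h ⊢ e₁ ⇓ v₁ , h₁ & w₁ →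
        ∃[ r ] at T₁ r w₁ × Ok (Γ [ x ↦ r ]ᵛ) (Γ₀ [ x ↦ C ]ᵛ) (s [ x ↦ v₁ ]ᵛ) h₁
      extendLet d con d₀ ok ev
        with hF , r , p , w∈ ← sound d con d₀ ok ev
           | hc , c ← preserve d₀ (store₀ ok) (heap₀ ok) ev =
        r , w∈ , extend (eval-⊑ ev) ok hF hc p c

      sound (sub d T⊆ _) con d₀ ok ev with hF , r , p , w∈ ← sound d con d₀ ok ev =
        hF , r , p , T⊆ r w∈
      sound (weak d) con d₀ ok ev with sound d con d₀ ok ev
      ... | hF , _ , p , inj₁ (refl , w∈) = hF , Unknown , unknown , inj₁ (refl , w∈)
      ... | hF , r , p , inj₂ w∈          = hF , r , p , inj₂ w∈
      sound prim con d₀ ok emit = heap ok , Null , null , refl , refl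
      sound null con d₀ ok null = heap ok , Null , null , refl , refl
      sound {h = h} new con d₀ ok ev@(new _) =
        ⊨F-update (eval-⊑ ev)
          (λ r f f∈ _ → null , newFields-null f∈ , Null , F-Null r f∈ , null) (heap ok) ,
        _ , created (update-atˡ h) (con _ _ here) , refl , refl
      sound (var Γx) con d₀ ok (var sx) =
        heap ok , _ , lookup-⊨ (store ok) Γx sx , refl , refl
      sound (if′ _ _ d₁ d₂) con d₀ ok (if-true _ _ ev)
        with hF , r , p , w∈ ← sound d₁ (λ ℓ C → con ℓ C ∘ then′) (proj₁ (if-inv d₀)) ok ev =
        hF , r , p , inj₁ w∈
      sound (if′ _ _ d₁ d₂) con d₀ ok (if-false _ _ _ ev)
        with hF , r , p , w∈ ← sound d₂ (λ ℓ C → con ℓ C ∘ else′) (proj₂ (if-inv d₀)) ok ev =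
        hF , r , p , inj₂ w∈
      sound (else′ Γx Γy dis d) con d₀ ok (if-true sx sy _) =
        ⊨-disjoint (lookup-⊨ (store ok) Γx sx) (lookup-⊨ (store ok) Γy sy) dis
      sound (else′ _ _ _ d) con d₀ ok (if-false _ _ _ ev) =
        sound d (λ ℓ C → con ℓ C ∘ else′) (proj₂ (if-inv d₀)) ok ev
      sound (let′ {T₁ = T₁} d₁ d₂) con d₀ ok (let′ ev₁ ev₂)
        with _ , d₀₁ , d₀₂ ← let-inv d₀
        with r₁ , w₁∈ , ok₁ ← extendLet d₁ (λ ℓ C → con ℓ C ∘ let₁) d₀₁ ok ev₁
        with r₁∈ ← at⇒dom T₁ w₁∈
        with hF , r , p , w₂∈ ← sound (d₂ r₁∈) (λ ℓ C → con ℓ C ∘ let₂) d₀₂ ok₁ ev₂ =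
        hF , r , p , r₁ , r₁∈ , _ , _ , w₁∈ , w₂∈ , refl
      sound (cast d) con d₀ ok (cast ev _ _) =
        sound d (λ ℓ C → con ℓ C ∘ cast) (proj₂ (cast-inv d₀)) ok ev
      sound (get rs Γx _ rs⇔) con d₀ ok (get sx hl Gf)
        with d₀x , f∈C ← get-inv d₀
        with D⪯C ← Conforms-loc⁻ hl (var-conforms d₀x (store₀ ok) sx)
        with f∈D ← fields-⊆ D⪯C (proj₁ (heap₀ ok _ _ hl)) f∈C
        -- The heap invariant concerns the entry of `F` at the dynamic class; `F-inh` then moves it
        -- to the annotation.
        with _ , Gf′ , r′ , r′∈ , p ← heap ok _ _ hl _ _ f∈D (lookup-⊨ (store ok) Γx sx)
        with refl ← trans (sym Gf) Gf′ =
        heap ok , r′ , p ,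
        r′ , Equivalence.from (rs⇔ r′) (proj₁ (F-inh _ D⪯C f∈D f∈C) r′∈) , refl , refl
      sound {h = h} (set {f = f} {r′ = r′} Γx Γy f∈C r′∈ ext) con d₀ ok
            ev@(set {l = l} {o} {v} sx hl sy) =
        ⊨F-update (eval-⊑ ev) written (heap ok) , _ , py , refl , refl
        where
        D⪯C = Conforms-loc⁻ hl (var-conforms (set-inv d₀) (store₀ ok) sx)
        px  = lookup-⊨ (store ok) Γx sx
        py  = ⊨-mono (eval-⊑ ev) (lookup-⊨ (store ok) Γy sy)
        written : ∀ q f′ → f′ ∈ fields (cls o) → loc l , _ ⊨ q →
                  ∃[ v′ ] (flds o [ f ↦ v ]ᶠ) f′ ≡ just v′ ×
                  (∃[ q′ ] F (cls o) q f′ q′ × (v′ , _ ⊨ q′))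
        written q f′ f′∈ pq with pq′ ← ⊨-transport (update-atˡ h) hl (refl , refl) pq | f′ ≟ᶠ f
        ... | yes refl = _ , refl , r′ , written-region hl D⪯C f′∈ f∈C r′∈ ext px pq′ , py
        ... | no _ with v′ , Gf , q′ , q′∈ , p ← heap ok _ _ hl q f′ f′∈ pq′ =
          v′ , Gf , q′ , q′∈ , ⊨-mono (eval-⊑ ev) p
      sound (call Γx Γys m∈C #C) con d₀ ok (call sx hl mt len args ev)
        with d₀x , m∈ , d₀ys ← call-inv d₀ =
        let act  = activate d₀x m∈ d₀ys (store₀ ok) (heap₀ ok) sx hl mt args
            act′ = regionActivate (store ok) Γx Γys sx hl mt len args
            open Activation act
            open RegionActivation act′ renaming (store to store′)
            hF , r′ , p , w∈ = sound (wellTyped m∈D #D D∈r mt) contained (bodies mt)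
                                 (mkOk store′ (heap ok) conforms (heap₀ ok)) ev
        in hF , r′ , p , proj₁ (M-inh m∈D #D m∈C #C D⪯C) r′ w∈

      -- Diverging runs up to the next call.

      module _ {R : DivRel} (step : ∀ {s h e w} → R s h e w → DivStep R s h e w) where

        -- Kept in `Set` to be comparable with `η`: the witness `R` of divergence is fixed outside,
        -- and the region derivation of the body, which lives in `Set₁`, is recovered from
        -- `wellTyped`.
        record Diverges (δ : Sig) (w : Word∞) : Set where
          constructor mkDiverges
          open Sig δ
          field
            {D} : Cls
            {zs} : List Var
            {e} : Expr
            {s} : Store
            {h} : Heap
            D⪯C  : D ⪯ σ-cls
            D∈r  : ClsOf σ-reg D
            m∈D  : σ-mtd ∈ methods D
            #D   : length σ-args ≡ arity D σ-mtd
            body : mtable D σ-mtd ≡ just (zs , e)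
            contained : Contained e
            ok   : Ok (bind σ-reg zs σ-args) (bind D zs (proj₁ (M₀ D σ-mtd))) s h
            run  : R s h e w

        -- The run gives no measure, so the recursion is on the region derivation and stops at a
        -- call, storing the body without entering it. In `divergesStep`, `sub` and `weak` descend
        -- without unfolding `R` again.
        diverges : ∀ {Γ Γ₀ e T S C₀ s h w} → Γ ⊢ e ∶ T calls S → Contained e → Γ₀ ⊢₀ e ∶ C₀ →
                   Ok Γ Γ₀ s h → R s h e w → (S ⟦ Diverges ⟧) w
        divergesStep : ∀ {Γ Γ₀ e T S C₀ s h w} → Γ ⊢ e ∶ T calls S → Contained e → Γ₀ ⊢₀ e ∶ C₀ →
                   Ok Γ Γ₀ s h → DivStep R s h e w → (S ⟦ Diverges ⟧) w

        diverges d con d₀ ok run = divergesStep d con d₀ ok (step run)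

        divergesStep (sub d _ S⊆) con d₀ ok st
          with δ , u , v , u∈ , rest ← divergesStep d con d₀ ok st = δ , u , v , S⊆ δ u∈ , rest
        divergesStep (weak d) con d₀ ok st = divergesStep d con d₀ ok st
        divergesStep (if′ _ _ d₁ d₂) con d₀ ok (if-true _ _ run)
          with δ , u , v , u∈ , rest ←
                 diverges d₁ (λ ℓ C → con ℓ C ∘ then′) (proj₁ (if-inv d₀)) ok run =
          δ , u , v , inj₁ u∈ , rest
        divergesStep (if′ _ _ d₁ d₂) con d₀ ok (if-false _ _ _ run)
          with δ , u , v , u∈ , rest ←
                 diverges d₂ (λ ℓ C → con ℓ C ∘ else′) (proj₂ (if-inv d₀)) ok run =
          δ , u , v , inj₂ u∈ , rest
        divergesStep (else′ Γx Γy dis d) con d₀ ok (if-true sx sy _) =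
          ⊨-disjoint (lookup-⊨ (store ok) Γx sx) (lookup-⊨ (store ok) Γy sy) dis
        divergesStep (else′ _ _ _ d) con d₀ ok (if-false _ _ _ run) =
          diverges d (λ ℓ C → con ℓ C ∘ else′) (proj₂ (if-inv d₀)) ok run
        divergesStep (let′ d₁ d₂) con d₀ ok (let₁ run)
          with _ , d₀₁ , _ ← let-inv d₀
          with δ , u , v , u∈ , rest ← diverges d₁ (λ ℓ C → con ℓ C ∘ let₁) d₀₁ ok run =
          δ , u , v , inj₁ u∈ , rest
        divergesStep (let′ {T₁ = T₁} d₁ d₂) con d₀ ok (let₂ {w₁ = w₁} ev run w≈)
          with _ , d₀₁ , d₀₂ ← let-inv d₀
          with r₁ , w₁∈ , ok₁ ← extendLet d₁ (λ ℓ C → con ℓ C ∘ let₁) d₀₁ ok ev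
          with r₁∈ ← at⇒dom T₁ w₁∈
          with δ , u , v , u∈ , v∈ , w₂≈ ←
                 diverges (d₂ r₁∈) (λ ℓ C → con ℓ C ∘ let₂) d₀₂ ok₁ run =
          δ , w₁ ++ u , v , inj₂ (r₁ , r₁∈ , w₁ , u , w₁∈ , u∈ , refl) , v∈ ,
          ≈-trans w≈ (≈-trans (++∞-congʳ w₁ w₂≈) (++∞-assoc w₁ u v))
        divergesStep (cast d) con d₀ ok (cast run) =
          diverges d (λ ℓ C → con ℓ C ∘ cast) (proj₂ (cast-inv d₀)) ok run
        divergesStep (call Γx Γys m∈C #C) con d₀ ok (call {w = w} sx hl mt len args run)
          with d₀x , m∈ , d₀ys ← call-inv d₀ =
          let act  = activate d₀x m∈ d₀ys (store₀ ok) (heap₀ ok) sx hl mt args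
              act′ = regionActivate (store ok) Γx Γys sx hl mt len args
              open Activation act
              open RegionActivation act′ renaming (store to store′)
          -- The prefix in `δ & ｛ε｝` is empty, so all of `w` is left to the body.
          in _ , [] , w , (refl , refl) ,
             mkDiverges D⪯C D∈r m∈D #D mt contained (mkOk store′ (heap ok) conforms (heap₀ ok)) run ,
             []-++∞ w

        -- The body is typed by the entry of `M` at the selected class `D`; `M-inh` enlarges its
        -- calls to those of `δ`.
        Diverges-unfolds : ∀ δ → Diverges δ ⊆ proj₂ (M δ) ⟦ Diverges ⟧
        Diverges-unfolds (sig C r m rs m∈C #C) (mkDiverges D⪯C D∈r m∈D #D body contained ok run)
          with δ′ , u , v , u∈ , rest ←
                 diverges (wellTyped m∈D #D D∈r body) contained (bodies body) ok run =
          δ′ , u , v , proj₂ (M-inh m∈D #D m∈C #C D⪯C) δ′ u∈ , rest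

      -- Infinite sequences of calls as a solution of the equation system.

      -- An explicit sequence, because the union of all post-fixpoints of δ = S_δ lives one
      -- universe too high to be compared with η.
      record Run (δ : Sig) (w : Word∞) : Set where
        field
          callee  : ℕ → Sig
          suffix  : ℕ → Word∞
          emitted : ℕ → Word
          start   : callee 0 ≡ δ × suffix 0 ≡ w
          next    : ∀ n → at (proj₂ (M (callee n))) (callee (suc n)) (emitted n) ×
                          suffix n ≈ emitted n ++∞ suffix (suc n)

      -- Dropping the first call and adding one in front give the two inclusions. If only empty
      -- words are emitted, the suffix is arbitrary, as in the greatest solution of `δ = δ`.
      Run-solution : Solution Run
      Run-solution δ = unfold , fold
        where
        unfold : Run δ ⊆ proj₂ (M δ) ⟦ Run ⟧
        unfold record { callee = c ; suffix = t ; emitted = u ; start = refl , refl ; next = next } =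
          c 1 , u 0 , t 1 , proj₁ (next 0) ,
          record { callee = c ∘ suc ; suffix = t ∘ suc ; emitted = u ∘ suc
                 ; start = refl , refl ; next = next ∘ suc } ,
          proj₂ (next 0)

        cons : {A : Set} → A → (ℕ → A) → ℕ → A
        cons a as zero    = a
        cons a as (suc n) = as n

        fold : proj₂ (M δ) ⟦ Run ⟧ ⊆ Run δ
        fold {w} (_ , u₀ , _ , u₀∈ , record { callee = c ; suffix = t ; emitted = u
                                            ; start = refl , refl ; next = next } , w≈) =
          record { callee = cons δ c ; suffix = cons w t ; emitted = cons u₀ u
                 ; start = refl , refl
                 ; next = λ { zero → u₀∈ , w≈ ; (suc n) → next n } }

      module _ (X : Sig → Pred Word∞ 0ℓ) (unfolds : ∀ δ → X δ ⊆ proj₂ (M δ) ⟦ X ⟧) where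

        -- `unfolds` acts as a choice function: the element of `X` kept at each stage yields the
        -- next signature and suffix, and again an element of `X`.
        iterate : ∀ {δ w} → X δ w → ℕ → ∃[ δ ] ∃[ w ] X δ w
        iterate x zero    = _ , _ , x
        iterate x (suc n) =
          let δ , _ , y = iterate x n
              δ′ , _ , w′ , _ , y′ , _ = unfolds δ y
          in δ′ , w′ , y′

        ⊆-Run : ∀ δ → X δ ⊆ Run δ
        ⊆-Run δ x = record
          { callee  = proj₁ ∘ iterate x
          ; suffix  = proj₁ ∘ proj₂ ∘ iterate x
          ; emitted = λ n → proj₁ (proj₂ (successor n))
          ; start   = refl , refl
          ; next    = λ n → let _ , _ , _ , u∈ , _ , w≈ = successor n in u∈ , w≈
          }
          where
          successor : ∀ n → let δ , w , _ = iterate x n in (proj₂ (M δ) ⟦ X ⟧) w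
          -- This is the same unfolding from which `iterate x (suc n)` projects, so consecutive
          -- stages fit by computation.
          successor n = let δ , _ , y = iterate x n in unfolds δ y

theorem4p8 : (N : Names) → let open Language N in
    (P : Program) → let open WithProgram P in
    (J : StandardTyping) → let open StandardTyping J in
    (𝒯 : ClassTable) → let open WithTable 𝒯 in
    WellTyped →
    ∀ η → InfinitaryEffectTyping η →
    ∀ {Γ e T S s h} → Γ ⊢ e ∶ T calls S → s , h ⊨ᵉ Γ → h ⊨F →
    (∀ ℓ C → ContainsNew ℓ C e → ContainedNew ℓ C) →
    ∀ {Γ₀ C₀} → Γ₀ ⊢₀ e ∶ C₀ → StoreConforms s h Γ₀ → HeapConforms h →
    (∀ {v h′ w} → s , h ⊢ e ⇓ v , h′ & w →
    (s , h′ ⊨ᵉ Γ) × (h′ ⊨F) × (∃[ r ] r ∈ dom T × (v , h′ ⊨ r) × at T r w)) ×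
    (∀ {w} → s , h ⊢ e ⇑& w → (S ⟦ η ⟧) w)
theorem4p8 N P J 𝒯 wt η ηtyping {T = T} d st hF con d₀ sc hc = terminating , diverging
  where
  open Language N
  open WithProgram P
  open WithTable 𝒯
  open Evaluation N P
  open Preservation J
  open Soundness 𝒯 wt
  open InfinitaryEffectTyping ηtyping

  ok = mkOk st hF sc hc

  terminating : ∀ {v h′ w} → _ , _ ⊢ _ ⇓ v , h′ & w → _
  terminating ev with hF′ , r , p , w∈ ← sound d con d₀ ok ev =
    ⊨ᵉ-mono (eval-⊑ ev) st , hF′ , r , at⇒dom T w∈ , p , w∈

  diverging : ∀ {w} → _ , _ ⊢ _ ⇑& w → _
  diverging (R , step , run) with δ , u , v , u∈ , dv , w≈ ← diverges step d con d₀ ok run =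
    δ , u , v , u∈ ,
    -- Only the suffix after the first call changes its membership, from `Diverges` through `Run` to
    -- `η`.
    greatest Run Run-solution δ (⊆-Run (Diverges step) (Diverges-unfolds step) δ dv) , w≈
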